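{- Let $(W,S)$ be a finite irreducible Coxeter system, let $w\in W$, and let $u,v\in\mathcal{R}(w)$ be two reduced words for $w$ that are related by a sequence of $k$ commutations (i.e. braid moves of length $2$). Then the $S$-sign function $\sigma$ and the $T$-sign function $\tau$ satisfy \[ \sigma(u)=(-1)^k\sigma(v)\qquad\text{and}\qquad \tau(u)=(-1)^k\tau(v). \]
   Context: $S=\{s_1<s_2<\dots<s_n\}$ is a totally ordered alphabet, $(m_{i,j})$ is the Coxeter matrix of $(W,S)$, and $\mathcal{R}(w)$ is the set of reduced words of $w$ (words in $S$ of minimal length representing $w$). A braid move of length $m_{i,j}$ ($i\neq j$) replaces a consecutive factor $s_is_js_i\cdots$ of length $m_{i,j}$ in a word by the factor $s_js_is_j\cdots$ of length $m_{i,j}$; a commutation is a braid move with $m_{i,j}=2$. For a word $w=w_1\cdots w_m$ in $S$, $\operatorname{inv}(w)$ is the number of pairs $a<b$ with $w_b<w_a$, and the $S$-sign is $\sigma(w):=(-1)^{\operatorname{inv}(w)}$. The $T$-sign function is a function $\tau:\mathcal{R}(w)\to\{+1,-1\}$ such that whenever $x,x'\in\mathcal{R}(w)$ are related by a single braid move of length $m_{i,j}$ one has $\tau(x)=(-1)^{m_{i,j}-1}\tau(x')$. Such a function is known to exist and is unique up to global multiplication by $-1$. -}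

module Defs where

open import Algebra.Bundles using (Group)
open import Data.Fin using (Fin; _<?_)
open import Data.List using (List; []; _∷_; _++_; map; foldr; filter; length; concat; replicate)
open import Data.Nat using (ℕ; zero; suc; _≤_; _∸_)
open import Data.Product using (_×_; _,_; ∃)
open import Data.Refinement using (Refinement; value)
open import Data.Sign using (Sign; _*_)
open import Function.Bundles using (Inverse; _⇔_)
open import Level using (Level; 0ℓ; _⊔_) renaming (suc to lsuc)
open import Relation.Binary.Core using (Rel)
open import Relation.Binary.Construct.Closure.Equivalence using (EqClosure)
open import Relation.Binary.Construct.Closure.ReflexiveTransitive using (Star)
open import Relation.Binary.PropositionalEquality using (_≡_; _≢_; setoid)
open import Relation.Nullary.Construct.Add.Supremum using (_⁺; [_])

-- The alphabet s₁ < s₂ < ⋯ < sₙ is Fin n with its usual order.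
Word : ℕ → Set
Word n = List (Fin n)

-- The entry ⊤⁺ of ℕ ⁺ stands for ∞.
record CoxeterMatrix (n : ℕ) : Set where
  field
    m           : Fin n → Fin n → ℕ ⁺
    symmetric   : ∀ i j → m i j ≡ m j i
    diagonal    : ∀ i → m i i ≡ [ 1 ]
    offDiagonal : ∀ {i j k} → i ≢ j → m i j ≡ [ k ] → 2 ≤ k

module _ {n : ℕ} (M : CoxeterMatrix n) where
  open CoxeterMatrix M

  data InsertRelator : Rel (Word n) 0ℓ where
    insert : ∀ a b {i j k} → m i j ≡ [ k ] →
             InsertRelator (a ++ b) (a ++ concat (replicate k (i ∷ j ∷ [])) ++ b)

  -- Equality in the group ⟨ s₁ , … , sₙ ∣ (sᵢ sⱼ)^m(i,j) = 1 ⟩.  Words need no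
  -- formal inverses, because the relators sᵢ sᵢ make each sᵢ its own inverse.
  CoxeterCongruence : Rel (Word n) 0ℓ
  CoxeterCongruence = EqClosure InsertRelator

  Adjacent : Rel (Fin n) 0ℓ
  Adjacent i j = i ≢ j × m i j ≢ [ 2 ]

  -- Connectedness of the Coxeter graph.
  IrreducibleMatrix : Set
  IrreducibleMatrix = ∀ i j → Star Adjacent i j

  alternating : Fin n → Fin n → ℕ → Word n
  alternating i j zero    = []
  alternating i j (suc k) = i ∷ alternating j i k

  data BraidMove (k : ℕ) : Rel (Word n) 0ℓ where
    braid : ∀ a b {i j} → i ≢ j → m i j ≡ [ k ] →
            BraidMove k (a ++ alternating i j k ++ b) (a ++ alternating j i k ++ b)

  Commutation : Rel (Word n) 0ℓ
  Commutation = BraidMove 2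

  data Commutations : ℕ → Rel (Word n) 0ℓ where
    done : ∀ {x} → Commutations zero x x
    step : ∀ {k x y z} → Commutation x y → Commutations k y z → Commutations (suc k) x z

record CoxeterSystem (n : ℕ) (c ℓ : Level) : Set (lsuc (c ⊔ ℓ)) where
  field
    group  : Group c ℓ
    matrix : CoxeterMatrix n

  open Group group public using (Carrier; _≈_; _∙_; ε) renaming (setoid to elements)

  field
    s : Fin n → Carrier

  ⟦_⟧ : Word n → Carrier
  ⟦ x ⟧ = foldr _∙_ ε (map s x)

  field
    generated : ∀ g → ∃ λ x → ⟦ x ⟧ ≈ g
    presented : ∀ x y → ⟦ x ⟧ ≈ ⟦ y ⟧ ⇔ CoxeterCongruence matrix x y

module _ {n : ℕ} {c ℓ : Level} (WS : CoxeterSystem n c ℓ) where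
  open CoxeterSystem WS

  IsFinite : Set (c ⊔ ℓ)
  IsFinite = ∃ λ N → Inverse (setoid (Fin N)) elements

  IsIrreducible : Set
  IsIrreducible = IrreducibleMatrix matrix

  IsReducedWord : Carrier → Word n → Set ℓ
  IsReducedWord w x = ⟦ x ⟧ ≈ w × (∀ y → ⟦ y ⟧ ≈ w → length x ≤ length y)

  -- The refinement keeps the proof of reducedness irrelevant, so that a
  -- function on ReducedWord w depends on the underlying word only.
  ReducedWord : Carrier → Set ℓ
  ReducedWord w = Refinement (Word n) (IsReducedWord w)

-1^_ : ℕ → Sign
-1^ zero  = Sign.+
-1^ suc k = Sign.- * -1^ k

infix 8 -1^_

-- All pairs (w_a , w_b) with positions a < b.
orderedPairs : ∀ {a} {A : Set a} → List A → List (A × A)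
orderedPairs []       = []
orderedPairs (x ∷ xs) = map (x ,_) xs ++ orderedPairs xs

inv : ∀ {n} → Word n → ℕ
inv x = length (filter (λ (p , q) → q <? p) (orderedPairs x))

S-sign : ∀ {n} → Word n → Sign
S-sign x = -1^ inv x

module _ {n : ℕ} {c ℓ : Level} (WS : CoxeterSystem n c ℓ) where
  open CoxeterSystem WS

  IsT-sign : ∀ {w} → (ReducedWord WS w → Sign) → Set ℓ
  IsT-sign τ = ∀ x x′ {k} → BraidMove matrix k (value x) (value x′) →
               τ x ≡ -1^ (k ∸ 1) * τ x′

{-# OPTIONS --safe #-}
module Submission where

open import Defs
open import Algebra.Bundles using (Group)
open import Data.Fin using (_<?_)
open import Data.Fin.Properties using (<-cmp)
import Data.Irrelevant as Irrelevant
open import Data.List using (List; []; _∷_; _++_; map; filter; length)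
open import Data.List.Properties using (++-assoc; length-++; filter-accept; filter-reject)
open import Data.List.Relation.Binary.Permutation.Propositional
  using (_↭_; ↭-refl; ↭-trans; prep; swap)
open import Data.List.Relation.Binary.Permutation.Propositional.Properties
  using (shift; shifts; ++⁺; ++⁺ˡ; map⁺; filter-↭; ↭-length)
open import Data.Nat using (ℕ; suc; _≤_)
open import Data.Product using (_×_; _,_; ∃)
open import Data.Refinement as Refinement using (value; proof)
open import Data.Sign using (Sign; _*_; opposite)
open import Data.Sign.Properties using (*-assoc; opposite-involutive)
open import Function.Bundles using (Equivalence)
open import Level using (Level)
open import Relation.Binary.Construct.Closure.Equivalence using (gmap)
open import Relation.Binary.Construct.Closure.ReflexiveTransitive using (ε; _◅_)
open import Relation.Binary.Construct.Closure.Symmetric using (fwd; bwd)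
open import Relation.Binary.Definitions using (tri<; tri≈; tri>)
open import Relation.Binary.PropositionalEquality
  using (_≡_; _≢_; refl; sym; trans; cong; subst; subst₂)
open import Relation.Nullary using (contradiction)
open import Relation.Nullary.Construct.Add.Supremum using ([_])

-- Exchanging two adjacent distinct letters affects only the relative order of those two letters, so
-- the inversion number changes by exactly one and each commutation negates `S-sign`. For the
-- T-sign, a move of length 2 contributes the factor `-1^ 1`, which is again a negation; but `τ`
-- lives on reduced words only, so each intermediate word must first be shown reduced
-- (`Commutation⇒reduced`). Both halves then follow by induction on the chain of commutations.

-- A single `ps` serves both words, so that comparing their inversions reduces to comparing one pair
-- with its reversal. Permutations suffice because inversions are only counted.
orderedPairs-swap : ∀ {a} {A : Set a} (xs ys : List A) {x y} →
  ∃ λ ps → orderedPairs (xs ++ x ∷ y ∷ ys) ↭ (x , y) ∷ ps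
         × orderedPairs (xs ++ y ∷ x ∷ ys) ↭ (y , x) ∷ ps
orderedPairs-swap [] ys {x} {y} =
  map (x ,_) ys ++ map (y ,_) ys ++ orderedPairs ys ,
  ↭-refl , prep (y , x) (shifts (map (y ,_) ys) (map (x ,_) ys))
orderedPairs-swap (z ∷ xs) ys {x} {y} with orderedPairs-swap xs ys {x} {y}
... | ps , p , q =
  map (z ,_) (xs ++ x ∷ y ∷ ys) ++ ps ,
  ↭-trans (++⁺ˡ _ p) (shift (x , y) _ ps) ,
  -- The pairs headed by `z` do not depend, up to permutation, on the order of the letters after
  -- `z`.
  ↭-trans (++⁺ (map⁺ (z ,_) (++⁺ˡ xs (swap y x ↭-refl))) q) (shift (y , x) _ ps)

S-sign-swap : ∀ {n} (a b : Word n) {i j} → i ≢ j →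
  S-sign (a ++ i ∷ j ∷ b) ≡ opposite (S-sign (a ++ j ∷ i ∷ b))
S-sign-swap a b {i} {j} i≢j with orderedPairs-swap a b {i} {j}
... | ps , p , q = trans (sign p) (trans (flip i j i≢j) (cong opposite (sym (sign q))))
  where
  descent? = λ ((p , q) : _ × _) → q <? p

  sign : ∀ {qs rs} → qs ↭ rs →
    -1^ length (filter descent? qs) ≡ -1^ length (filter descent? rs)
  sign r = cong -1^_ (↭-length (filter-↭ descent? r))

  -- By trichotomy exactly one of `(i , j)` and `(j , i)` is a descent, so the two counts differ by
  -- one.
  flip : ∀ i j → i ≢ j →
    -1^ length (filter descent? ((i , j) ∷ ps)) ≡
    opposite (-1^ length (filter descent? ((j , i) ∷ ps)))
  flip i j i≢j with <-cmp i j
  ... | tri≈ _ i≡j _ = contradiction i≡j i≢j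
  ... | tri< i<j _ j≮i
    rewrite filter-reject descent? {i , j} {ps} j≮i
          | filter-accept descent? {j , i} {ps} i<j = sym (opposite-involutive _)
  ... | tri> i≮j _ j<i
    rewrite filter-accept descent? {i , j} {ps} j<i
          | filter-reject descent? {j , i} {ps} i≮j = refl

module _ {n : ℕ} (M : CoxeterMatrix n) where
  open CoxeterMatrix M

  -- Lets `commute` work with the prefix `a` stripped off, where the words involved agree by
  -- computation.
  InsertRelator-++⁺ˡ : ∀ a {x y} → InsertRelator M x y → InsertRelator M (a ++ x) (a ++ y)
  InsertRelator-++⁺ˡ a (insert a′ b e) =
    subst₂ (InsertRelator M) (++-assoc a a′ b) (++-assoc a a′ _) (insert (a ++ a′) b e)

  -- ij = ij(ii) = iji(jj)i = (ij)²ji = ji.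
  commute : ∀ a b {i j} → m i j ≡ [ 2 ] →
    CoxeterCongruence M (a ++ i ∷ j ∷ b) (a ++ j ∷ i ∷ b)
  commute a b {i} {j} e = gmap (a ++_) (InsertRelator-++⁺ˡ a)
    ( fwd (insert (i ∷ j ∷ []) b (diagonal i))
    ◅ fwd (insert (i ∷ j ∷ i ∷ []) (i ∷ b) (diagonal j))
    ◅ bwd (insert [] (j ∷ i ∷ b) e)
    ◅ ε)

  Commutation⇒length≡ : ∀ {x y} → Commutation M x y → length x ≡ length y
  Commutation⇒length≡ (braid a b _ _) = trans (length-++ a) (sym (length-++ a))

  Commutation⇒S-sign : ∀ {x y} → Commutation M x y → S-sign x ≡ opposite (S-sign y)
  Commutation⇒S-sign (braid a b i≢j _) = S-sign-swap a b i≢j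

  Commutations⇒S-sign : ∀ {k x y} → Commutations M k x y → S-sign x ≡ -1^ k * S-sign y
  Commutations⇒S-sign done = refl
  Commutations⇒S-sign {suc k} (step c cs) =
    trans (Commutation⇒S-sign c)
      (trans (cong opposite (Commutations⇒S-sign cs)) (sym (*-assoc Sign.- (-1^ k) _)))

module _ {c ℓ : Level} {n : ℕ} (WS : CoxeterSystem n c ℓ) where
  open CoxeterSystem WS using (matrix; group; presented)

  -- The presentation turns `commute` into an equality of group elements, and a commutation
  -- preserves length, so minimality carries over.
  Commutation⇒reduced : ∀ {w x y} → Commutation matrix x y →
    IsReducedWord WS w x → IsReducedWord WS w y
  Commutation⇒reduced r@(braid a b _ e) (x≈w , minimal) =
    Group.trans group
      (Group.sym group (Equivalence.from (presented _ _) (commute matrix a b e))) x≈w ,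
    λ z z≈w → subst (_≤ length z) (Commutation⇒length≡ matrix r) (minimal z z≈w)

  Commutations⇒T-sign : ∀ {w} (τ : ReducedWord WS w → Sign) → IsT-sign WS τ →
    ∀ {k} (u v : ReducedWord WS w) → Commutations matrix k (value u) (value v) →
    τ u ≡ -1^ k * τ v
  -- Both arguments have the same underlying word and their proofs of reducedness are irrelevant, so
  -- they are definitionally equal.
  Commutations⇒T-sign τ isT _ _ done = refl
  Commutations⇒T-sign {w} τ isT {suc k} u v (step {y = y} c cs) =
    -- With `k` equal to 2 in `IsT-sign`, the factor `-1^ 1` computes to `opposite`.
    trans (isT u y′ c)
      (trans (cong opposite (Commutations⇒T-sign τ isT y′ v cs)) (sym (*-assoc Sign.- (-1^ k) _)))
    where
    y′ : ReducedWord WS w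
    y′ = y Refinement., Irrelevant.map (Commutation⇒reduced c) (proof u)

corollary1 : ∀ {c ℓ : Level} {n : ℕ} (WS : CoxeterSystem n c ℓ) →
    IsFinite WS → IsIrreducible WS →
    (w : CoxeterSystem.Carrier WS)
    (τ : ReducedWord WS w → Sign) → IsT-sign WS τ →
    (u v : ReducedWord WS w) (k : ℕ) →
    Commutations (CoxeterSystem.matrix WS) k (value u) (value v) →
    (S-sign (value u) ≡ -1^ k * S-sign (value v)) × (τ u ≡ -1^ k * τ v)
corollary1 WS _ _ _ τ isT u v k cs =
  Commutations⇒S-sign (CoxeterSystem.matrix WS) cs , Commutations⇒T-sign WS τ isT u v cs
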